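{- Let $n\ge2$ and $a,b$ be positive integers, $h(j)=aj^n+b$ for $j\ge0$, $h(j)=0$ for $j<0$, $\alpha=a/b$ and $c(h)=\lfloor\alpha\rfloor+1$. Then $\operatorname{hdepth}(h)\le \operatorname{eq}(h)$. Moreover, if $c(h)\le 4$, then $\operatorname{hdepth}(h)=\operatorname{eq}(h)$.
   Context: For a nonzero function $h:\mathbb Z\to\mathbb Z_{\ge 0}$ with $h(j)=0$ for all sufficiently negative $j$, and integers $k\le d$, set $\beta_k^d(h)=\sum_{j\le k}(-1)^{k-j}\binom{d-j}{k-j}h(j)$, and $\operatorname{hdepth}(h)=\max\{d\in\mathbb Z:\ \beta_k^d(h)\ge 0\text{ for all integers }k\le d\}$. For $1\le i\le 2^n-1$ put $m=2^n+1-i$ and $\lambda_i=\dfrac{m^2+m(2^{n+1}-3)+2^{2n}-3\cdot2^n+4}{2m-2}$ (so $\lambda_1<\lambda_2<\dots<\lambda_{2^n-1}$). Define $$\operatorname{eq}(h)=\begin{cases}c(h),&\alpha\in(0,2^{n+1}-1),\\ 2^{n+1},&\alpha\in[2^{n+1}-1,\lambda_1],\\ 2^{n+1}+1-i,&\alpha\in(\lambda_{i-1},\lambda_i]\ \text{ for } 2\le i\le 2^n-1,\\ 2^n+1,&\alpha\in(\lambda_{2^n-1},\infty).\end{cases}$$ -}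

module Defs where

open import Data.Bool using (if_then_else_)
open import Data.Fin using (toℕ)
open import Data.Integer as ℤ using (ℤ; +_; -[1+_]; 0ℤ; -1ℤ; ∣_∣)
import Data.Integer.Properties as ℤ
open import Data.List using (List; applyUpTo; find)
open import Data.Maybe using (maybe)
open import Data.Nat as ℕ using (ℕ; suc; NonZero)
import Data.Nat.Properties as ℕ
open import Data.Nat.Combinatorics using (_C_)
open import Data.Product using (_×_; _,_; ∃-syntax)
open import Data.Rational.Unnormalised as ℚ using (ℚᵘ; mkℚᵘ; floor)
import Data.Rational.Unnormalised.Properties as ℚ
open import Relation.Binary.PropositionalEquality using (_≡_; _≢_; refl)
open import Relation.Nullary using (does)
open import Relation.Nullary.Decidable using (_×-dec_)

open import Algebra.Properties.Monoid.Sum ℤ.+-0-monoid using (sum-syntax)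

record LeftBoundedFunction : Set where
  field
    fun      : ℤ → ℕ
    bound    : ℤ
    vanishes : ∀ j → j ℤ.< bound → fun j ≡ 0
    nonzero  : ∃[ j ] fun j ≢ 0

open LeftBoundedFunction

-- The number of integers j with l ≤ j ≤ k, as a function of k - l.
count : ℤ → ℕ
count (+ m)    = suc m
count -[1+ _ ] = 0

-- The summand (-1)^(k-j) (d-j choose k-j) h(j).  It is only used for
-- j ≤ k ≤ d, where the absolute values are the differences themselves.
βterm : (ℤ → ℕ) → (d k j : ℤ) → ℤ
βterm h d k j =
  -1ℤ ℤ.^ ∣ k ℤ.- j ∣ ℤ.* + (∣ d ℤ.- j ∣ C ∣ k ℤ.- j ∣) ℤ.* + h j

-- The sum over all j ≤ k; the terms with j < bound h are zero, so j runs
-- through bound h, bound h + 1, …, k.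
β : LeftBoundedFunction → (d k : ℤ) → ℤ
β h d k =
  ∑[ i < count (k ℤ.- bound h) ] βterm (fun h) d k (bound h ℤ.+ + toℕ i)

AllβNonnegative : LeftBoundedFunction → ℤ → Set
AllβNonnegative h d = ∀ k → k ℤ.≤ d → 0ℤ ℤ.≤ β h d k

-- IsHdepth h D says that the maximum defining hdepth(h) exists and equals D.
IsHdepth : LeftBoundedFunction → ℤ → Set
IsHdepth h D = AllβNonnegative h D × (∀ d → AllβNonnegative h d → d ℤ.≤ D)

IsHdepth-unique : ∀ h {D E} → IsHdepth h D → IsHdepth h E → D ≡ E
IsHdepth-unique h (pD , maxD) (pE , maxE) =
  ℤ.≤-antisym (maxE _ pD) (maxD _ pE)

powerFunction : (n a b : ℕ) → .{{NonZero b}} → LeftBoundedFunction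
powerFunction n a b = record
  { fun      = h
  ; bound    = 0ℤ
  ; vanishes = h-vanishes
  ; nonzero  = 0ℤ , λ h0≡0 →
      ℕ.≢-nonZero⁻¹ b (ℕ.m+n≡0⇒n≡0 (a ℕ.* 0 ℕ.^ n) h0≡0)
  }
  where
  h : ℤ → ℕ
  h (+ j)    = a ℕ.* j ℕ.^ n ℕ.+ b
  h -[1+ _ ] = 0

  h-vanishes : ∀ j → j ℤ.< 0ℤ → h j ≡ 0
  h-vanishes (+ _)    (ℤ.+<+ ())
  h-vanishes -[1+ _ ] _ = refl

c : ℚᵘ → ℤ
c α = floor α ℤ.+ + 1

-- Used for 1 ≤ i ≤ 2^n - 1 only.  Then m = 2^n + 1 - i ≥ 2, so the truncated
-- subtractions are exact.  The second argument of mkℚᵘ is the denominator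
-- minus one, which makes the denominator 2m - 2.
lam : (n i : ℕ) → ℚᵘ
lam n i = mkℚᵘ numerator (2 ℕ.* m ℕ.∸ 3)
  where
  m : ℕ
  m = 2 ℕ.^ n ℕ.+ 1 ℕ.∸ i

  numerator : ℤ
  numerator =
    (+ m) ℤ.^ 2 ℤ.+ + m ℤ.* (+ (2 ℕ.^ (n ℕ.+ 1)) ℤ.- + 3)
      ℤ.+ + (2 ℕ.^ (2 ℕ.* n)) ℤ.- + 3 ℤ.* + (2 ℕ.^ n) ℤ.+ + 4

-- The indices 2, 3, …, 2^n - 1.
middleIndices : ℕ → List ℕ
middleIndices n = applyUpTo (2 ℕ.+_) (2 ℕ.^ n ℕ.∸ 2)

-- For α > 0.  Since lam n is increasing, at most one i has
-- lam n (i - 1) < α ≤ lam n i, and the search finds none of the middle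
-- intervals exactly when α exceeds lam n (2^n - 1).
eq : ℕ → ℚᵘ → ℤ
eq n α =
  if does (α ℚ.<? (+ (2 ℕ.^ (n ℕ.+ 1)) ℤ.- + 1) ℚ./ 1) then
    c α
  else if does (α ℚ.≤? lam n 1) then
    + (2 ℕ.^ (n ℕ.+ 1))
  else
    maybe (λ i → + (2 ℕ.^ (n ℕ.+ 1)) ℤ.+ + 1 ℤ.- + i)
          (+ (2 ℕ.^ n) ℤ.+ + 1)
          (find (λ i → (lam n (i ℕ.∸ 1) ℚ.<? α) ×-dec (α ℚ.≤? lam n i))
                (middleIndices n))

{-# OPTIONS --safe #-}
-- Pascal's rule gives β_k^d = β_k^{d+1} + β_{k-1}^d, so the admissible d form a
-- down-closed set and one negative β_k^d bounds hdepth by d - 1.  For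
-- h(j) = a j^n + b, β_1^{d+1} = a - d b bounds hdepth by c, and with N = 2^n
-- 2 β_2^d = 2a (N + 1 - d) + b ((d-1)(d-2) + 2) is negative at d = N + m as soon as
-- α > λ_i, where m = N + 1 - i.  If c ≤ 4 then d = c ≤ 4 is admissible, since
-- only β_k^d with k ≤ d ≤ 4 occur and 2·2^n ≤ 3^n ≤ 4^n.
module Submission where

open import Defs
open import Data.Bool using (if_then_else_)
open import Data.Fin using (toℕ)
open import Data.Fin.Properties using (toℕ≤pred[n])
open import Data.Integer as ℤ using (ℤ; +_; -[1+_]; 0ℤ; -1ℤ; ∣_∣; _≤_)
import Data.Integer.DivMod as ℤ
import Data.Integer.Properties as ℤ
open import Data.Integer.Tactic.RingSolver using (solve-∀)
open import Data.List using ([]; _∷_; find)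
open import Data.List.Membership.Propositional using (_∈_)
open import Data.List.Membership.Propositional.Properties using (∈-applyUpTo⁻)
open import Data.List.Relation.Unary.All using (All; []; _∷_)
open import Data.List.Relation.Unary.All.Properties using (applyUpTo⁻)
open import Data.List.Relation.Unary.Any using (here; there)
open import Data.Maybe using (maybe)
open import Data.Nat as ℕ using (ℕ; zero; suc; z≤n; s≤s; NonZero; _∸_) renaming (_≤_ to _≤ᴺ_)
open import Data.Nat.Combinatorics using (_C_; nCk+nC[k+1]≡[n+1]C[k+1]; nC1≡n)
import Data.Nat.DivMod as ℕ
import Data.Nat.Properties as ℕ
open import Data.Product using (_×_; _,_; ∃-syntax; proj₁; proj₂)
open import Data.Rational.Unnormalised as ℚ using (ℚᵘ; mkℚᵘ; floor; _/_)
import Data.Rational.Unnormalised.Properties as ℚ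
open import Function using (_∘_)
open import Relation.Binary.PropositionalEquality
open import Relation.Nullary using (¬_; Dec; yes; no; does; contradiction)
open import Relation.Nullary.Decidable using (_×-dec_)
open import Relation.Unary using (Decidable)

open import Algebra.Properties.Monoid.Sum ℤ.+-0-monoid using (sum; sum-cong-≗)

open LeftBoundedFunction

-- Sums over natural indices and Pascal's rule.

∣m-n∣≡m∸n : ∀ {m n} → n ℕ.≤ m → ∣ + m ℤ.- + n ∣ ≡ m ∸ n
∣m-n∣≡m∸n {m} {n} n≤m = cong ∣_∣ (trans (ℤ.m-n≡m⊖n m n) (ℤ.⊖-≥ n≤m))

signedC : ℕ → ℕ → ℤ
signedC d k = -1ℤ ℤ.^ k ℤ.* + (d C k)

-- Splitting off j = 0 lowers `d` and `k` together and leaves, definitionally, a sum for `f ∘ suc`;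
-- this drives the induction in `βℕ-pascal`.
βℕ : (ℕ → ℕ) → ℕ → ℕ → ℤ
βℕ f d k = sum {suc k} λ i →
  signedC (d ∸ toℕ i) (k ∸ toℕ i) ℤ.* + f (toℕ i)

β≡βℕ : ∀ h → bound h ≡ 0ℤ → ∀ {d k} → k ℕ.≤ d →
       β h (+ d) (+ k) ≡ βℕ (fun h ∘ +_) d k
β≡βℕ h bound≡0 {d} {k} k≤d = trans (cong from bound≡0) (trans
  (cong (λ m → sum {suc m} λ i → βterm (fun h) (+ d) (+ k) (+ toℕ i))
    (ℕ.+-identityʳ k))
  (sum-cong-≗ {suc k} λ i → term (toℕ≤pred[n] i)))
  where
  -- Abstracting over the lower bound lets `bound h` become `0ℤ` in the range and in the index at
  -- once.
  from : ℤ → ℤ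
  from l = sum {count (+ k ℤ.- l)} λ i →
    βterm (fun h) (+ d) (+ k) (l ℤ.+ + toℕ i)

  term : ∀ {j} → j ℕ.≤ k →
         βterm (fun h) (+ d) (+ k) (+ j) ≡ signedC (d ∸ j) (k ∸ j) ℤ.* + fun h (+ j)
  term {j} j≤k = cong₂ (λ m l → -1ℤ ℤ.^ m ℤ.* + (l C m) ℤ.* + fun h (+ j))
    (∣m-n∣≡m∸n j≤k) (∣m-n∣≡m∸n (ℕ.≤-trans j≤k k≤d))

-- The sign flips between `k` and `suc k`, so `signedC d k` cancels one of the two binomials into
-- which Pascal's rule splits the first summand.
signedC-pascal : ∀ d k →
  signedC (suc d) (suc k) ℤ.+ signedC d k ≡ signedC d (suc k)
signedC-pascal d k = trans
  (cong (λ x → -1ℤ ℤ.* s ℤ.* + x ℤ.+ s ℤ.* + (d C k))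
    (sym (nCk+nC[k+1]≡[n+1]C[k+1] d k)))
  (ring s (+ (d C k)) (+ (d C suc k)))
  where
  s = -1ℤ ℤ.^ k
  ring : ∀ s x y → -1ℤ ℤ.* s ℤ.* (x ℤ.+ y) ℤ.+ s ℤ.* x ≡ -1ℤ ℤ.* s ℤ.* y
  ring = solve-∀

βℕ-zero : ∀ f d → βℕ f d 0 ≡ + f 0
βℕ-zero f d = trans (ℤ.+-identityʳ _) (ℤ.*-identityˡ _)

βℕ-pascal : ∀ f {d k} → k ℕ.< d →
  βℕ f d (suc k) ≡ βℕ f (suc d) (suc k) ℤ.+ βℕ f d k
βℕ-pascal f {suc d} {k} (s≤s k≤d) = trans
  (cong₂ (λ x y → x ℤ.* + f 0 ℤ.+ y) (sym (signedC-pascal (suc d) k)) (tails k≤d))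
  (ring (signedC (suc (suc d)) (suc k)) (signedC (suc d) k) (+ f 0)
    (βℕ (f ∘ suc) (suc d) k) (tail k))
  where
  -- This is `βℕ f (suc d) k` without its term at j = 0, hence empty for `k` = 0.
  tail : ℕ → ℤ
  tail k = sum {k} λ i →
    signedC (d ∸ toℕ i) (k ∸ suc (toℕ i)) ℤ.* + f (suc (toℕ i))

  tails : ∀ {k} → k ℕ.≤ d → βℕ (f ∘ suc) d k ≡ βℕ (f ∘ suc) (suc d) k ℤ.+ tail k
  tails {zero}  _   = trans (βℕ-zero (f ∘ suc) d)
    (sym (trans (ℤ.+-identityʳ _) (βℕ-zero (f ∘ suc) (suc d))))
  tails {suc k} k<d = βℕ-pascal (f ∘ suc) k<d

  ring : ∀ p q x y z →
    (p ℤ.+ q) ℤ.* x ℤ.+ (y ℤ.+ z) ≡ p ℤ.* x ℤ.+ y ℤ.+ (q ℤ.* x ℤ.+ z)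
  ring = solve-∀

-- Admissible depths and their maximum.

Nonnegative : (ℕ → ℕ) → ℕ → Set
Nonnegative f d = ∀ {k} → k ℕ.< suc d → 0ℤ ≤ βℕ f d k

nonnegative? : ∀ f → Decidable (Nonnegative f)
nonnegative? f d = ℕ.allUpTo? (λ k → 0ℤ ℤ.≤? βℕ f d k) (suc d)

nonnegative-zero : ∀ f → Nonnegative f 0
nonnegative-zero f {zero} _ = subst (0ℤ ≤_) (sym (βℕ-zero f 0)) (ℤ.+≤+ z≤n)
nonnegative-zero f {suc _} (s≤s ())

-- Induction on `k`: by Pascal's rule the entry at `suc k` is one of depth `suc d` plus the entry at
-- `k` of depth `d`.
nonnegative-pred : ∀ f d → Nonnegative f (suc d) → Nonnegative f d
nonnegative-pred f d p {zero} _ = subst (0ℤ ≤_) (sym (βℕ-zero f d)) (ℤ.+≤+ z≤n)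
nonnegative-pred f d p {suc k} (s≤s k<d) = subst (0ℤ ≤_) (sym (βℕ-pascal f k<d))
  (ℤ.+-mono-≤ (p (s≤s (ℕ.m≤n⇒m≤1+n k<d))) (nonnegative-pred f d p (ℕ.m≤n⇒m≤1+n k<d)))

IsMaximum : (ℕ → Set) → ℕ → Set
IsMaximum P m = P m × (∀ d → P d → d ℕ.≤ m)

module _ {P : ℕ → Set} (P? : Decidable P) (P-pred : ∀ d → P (suc d) → P d) where

  downward : ∀ {m n} → m ℕ.≤ n → P n → P m
  downward m≤n = go (ℕ.≤⇒≤′ m≤n)
    where
    go : ∀ {m n} → m ℕ.≤′ n → P n → P m
    go ℕ.≤′-refl       p = p
    go (ℕ.≤′-step m≤n) p = go m≤n (P-pred _ p)

  -- A failure at `n` rules out every larger depth, so the first success when counting down is the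
  -- maximum.
  maximum : P 0 → ∀ n → ¬ P n → ∃[ m ] IsMaximum P m
  maximum p₀ zero    ¬p = contradiction p₀ ¬p
  maximum p₀ (suc n) ¬p with P? n
  ... | yes p = n , p , λ d pd → ℕ.≮⇒≥ λ n<d → ¬p (downward n<d pd)
  ... | no ¬q = maximum p₀ n ¬q

-- For negative k the sum is empty, and negative depths lie below `D`, so natural d and k decide
-- everything.
isHdepth : ∀ h → bound h ≡ 0ℤ → ∀ {D} →
           IsMaximum (Nonnegative (fun h ∘ +_)) D → IsHdepth h (+ D)
isHdepth h bound≡0 {D} (p , max) = all , greatest
  where
  β-negative : ∀ d k → β h d -[1+ k ] ≡ 0ℤ
  β-negative d k = cong (λ l → sum {count (-[1+ k ] ℤ.- l)} λ i →
    βterm (fun h) d -[1+ k ] (l ℤ.+ + toℕ i)) bound≡0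

  all : AllβNonnegative h (+ D)
  all (+ k)    (ℤ.+≤+ k≤D) = subst (0ℤ ≤_) (sym (β≡βℕ h bound≡0 k≤D)) (p (s≤s k≤D))
  all -[1+ k ] _           = ℤ.≤-reflexive (sym (β-negative (+ D) k))

  greatest : ∀ d → AllβNonnegative h d → d ≤ + D
  greatest (+ d)    q = ℤ.+≤+ (max d λ where
    (s≤s k≤d) → subst (0ℤ ≤_) (β≡βℕ h bound≡0 k≤d) (q _ (ℤ.+≤+ k≤d)))
  greatest -[1+ d ] _ = ℤ.-≤+

-- Closed forms for k = 1 and k = 2.

2*nC2 : ∀ n → + 2 ℤ.* + (suc n C 2) ≡ + suc n ℤ.* + n
2*nC2 zero    = refl
2*nC2 (suc n) = trans
  (cong (λ x → + 2 ℤ.* + x) (sym (nCk+nC[k+1]≡[n+1]C[k+1] (suc n) 1)))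
  (trans (cong (λ x → + 2 ℤ.* (+ x ℤ.+ + (suc n C 2))) (nC1≡n (suc n)))
    (trans (ring₁ (+ n) (+ (suc n C 2)))
    (trans (cong (λ x → x ℤ.+ + 2 ℤ.* (+ 1 ℤ.+ + n)) (2*nC2 n))
      (ring₂ (+ n)))))
  where
  ring₁ : ∀ x y → + 2 ℤ.* ((+ 1 ℤ.+ x) ℤ.+ y) ≡ + 2 ℤ.* y ℤ.+ + 2 ℤ.* (+ 1 ℤ.+ x)
  ring₁ = solve-∀
  ring₂ : ∀ x → (+ 1 ℤ.+ x) ℤ.* x ℤ.+ + 2 ℤ.* (+ 1 ℤ.+ x) ≡ (+ 2 ℤ.+ x) ℤ.* (+ 1 ℤ.+ x)
  ring₂ = solve-∀

βℕ-one : ∀ f d → βℕ f d 1 ≡ + f 1 ℤ.- + d ℤ.* + f 0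
βℕ-one f d = trans
  (cong (λ x → -1ℤ ℤ.* + x ℤ.* + f 0 ℤ.+ (+ 1 ℤ.* + f 1 ℤ.+ 0ℤ)) (nC1≡n d))
  (ring (+ d) (+ f 0) (+ f 1))
  where
  ring : ∀ d x y → -1ℤ ℤ.* d ℤ.* x ℤ.+ (+ 1 ℤ.* y ℤ.+ + 0) ≡ y ℤ.- d ℤ.* x
  ring = solve-∀

-- Doubling turns the binomial d choose 2, with d = `suc e`, into a polynomial in `e`.
2*βℕ-two : ∀ f e → + 2 ℤ.* βℕ f (suc e) 2 ≡
  + 2 ℤ.* + f 2 ℤ.- + 2 ℤ.* + e ℤ.* + f 1 ℤ.+ + suc e ℤ.* + e ℤ.* + f 0
2*βℕ-two f e = trans
  (cong (λ x → + 2 ℤ.* (+ 1 ℤ.* + (suc e C 2) ℤ.* + f 0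
      ℤ.+ (-1ℤ ℤ.* + x ℤ.* + f 1 ℤ.+ (+ 1 ℤ.* + f 2 ℤ.+ 0ℤ))))
    (nC1≡n e))
  (trans (ring (+ (suc e C 2)) (+ e) (+ f 0) (+ f 1) (+ f 2))
    (cong (λ x → + 2 ℤ.* + f 2 ℤ.- + 2 ℤ.* + e ℤ.* + f 1 ℤ.+ x ℤ.* + f 0) (2*nC2 e)))
  where
  ring : ∀ c e x y z →
    + 2 ℤ.* (+ 1 ℤ.* c ℤ.* x ℤ.+ (-1ℤ ℤ.* e ℤ.* y ℤ.+ (+ 1 ℤ.* z ℤ.+ + 0)))
    ≡ + 2 ℤ.* z ℤ.- + 2 ℤ.* e ℤ.* y ℤ.+ + 2 ℤ.* c ℤ.* x
  ring = solve-∀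

-- Functions a w(j) + b and depths up to 4.

affine : (ℕ → ℕ) → ℕ → ℕ → ℕ → ℕ
affine w a b j = a ℕ.* w j ℕ.+ b

module _ (w : ℕ → ℕ) (w₀ : w 0 ≡ 0) (w₁ : w 1 ≡ 1) (a b : ℕ) where

  private
    f = affine w a b

  f₀ : f 0 ≡ b
  f₀ = cong (ℕ._+ b) (trans (cong (a ℕ.*_) w₀) (ℕ.*-zeroʳ a))

  f₁ : f 1 ≡ a ℕ.+ b
  f₁ = cong (ℕ._+ b) (trans (cong (a ℕ.*_) w₁) (ℕ.*-identityʳ a))

  affine-βℕ-one : ∀ d → βℕ f (suc d) 1 ≡ + a ℤ.- + (d ℕ.* b)
  affine-βℕ-one d = trans (βℕ-one f (suc d))
    (trans (cong₂ (λ x y → + x ℤ.- + suc d ℤ.* + y) f₁ f₀)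
    (trans (ring (+ a) (+ b) (+ d)) (cong (λ x → + a ℤ.- x) (sym (ℤ.pos-* d b)))))
    where
    ring : ∀ a b d → a ℤ.+ b ℤ.- (+ 1 ℤ.+ d) ℤ.* b ≡ a ℤ.- d ℤ.* b
    ring = solve-∀

  2*affine-βℕ-two : ∀ e → + 2 ℤ.* βℕ f (suc e) 2 ≡
    + 2 ℤ.* + a ℤ.* (+ w 2 ℤ.- + e) ℤ.+ + b ℤ.* (+ e ℤ.* (+ e ℤ.- + 1) ℤ.+ + 2)
  2*affine-βℕ-two e = trans (2*βℕ-two f e)
    (trans (cong₂ (λ x y → + 2 ℤ.* + f 2 ℤ.- + 2 ℤ.* + e ℤ.* + x
        ℤ.+ + suc e ℤ.* + e ℤ.* + y)
      f₁ f₀)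
    (trans (cong (λ x → + 2 ℤ.* (x ℤ.+ + b) ℤ.- + 2 ℤ.* + e ℤ.* + (a ℕ.+ b)
        ℤ.+ + suc e ℤ.* + e ℤ.* + b)
      (ℤ.pos-* a (w 2)))
    (ring (+ a) (+ b) (+ e) (+ w 2))))
    where
    ring : ∀ a b e w →
      + 2 ℤ.* (a ℤ.* w ℤ.+ b) ℤ.- + 2 ℤ.* e ℤ.* (a ℤ.+ b) ℤ.+ (+ 1 ℤ.+ e) ℤ.* e ℤ.* b
      ≡ + 2 ℤ.* a ℤ.* (w ℤ.- e) ℤ.+ b ℤ.* (e ℤ.* (e ℤ.- + 1) ℤ.+ + 2)
    ring = solve-∀

  -- At k = 1 the entry is a - d b. The contrapositive yields the bounds `c` and 2^(n+1) on the
  -- depth.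
  nonnegative⇒d*b≤a : ∀ {d} → Nonnegative f (suc d) → d ℕ.* b ℕ.≤ a
  nonnegative⇒d*b≤a {d} p = ℤ.drop‿+≤+
    (ℤ.0≤i-j⇒j≤i (subst (0ℤ ≤_) (affine-βℕ-one d) (p (s≤s (s≤s z≤n)))))

  module _ (w₂≥4 : 4 ℕ.≤ w 2) (w₃≥2*w₂ : 2 ℕ.* w 2 ℕ.≤ w 3) (w₄≥w₃ : w 3 ℕ.≤ w 4) where

    private
      -- Slack variables: w 2 = 1 + u, w 3 = 2 w 2 + v and w 4 = w 3 + t turn inequalities into ring
      -- identities over nonnegative unknowns.
      u = ℕ.pred (w 2)
      v = w 3 ∸ 2 ℕ.* w 2
      t = w 4 ∸ w 3

    w₂≡ : + w 2 ≡ + 1 ℤ.+ + u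
    w₂≡ = cong +_ (sym (ℕ.suc-pred (w 2) {{ℕ.>-nonZero (ℕ.≤-trans (s≤s z≤n) w₂≥4)}}))

    w₃≡ : + w 3 ≡ + 2 ℤ.* (+ 1 ℤ.+ + u) ℤ.+ + v
    w₃≡ = trans (cong +_ (sym (ℕ.m+[n∸m]≡n w₃≥2*w₂)))
      (cong (ℤ._+ + v) (trans (ℤ.pos-* 2 (w 2)) (cong (+ 2 ℤ.*_) w₂≡)))

    w₄≡ : + w 4 ≡ + 2 ℤ.* (+ 1 ℤ.+ + u) ℤ.+ + v ℤ.+ + t
    w₄≡ = trans (cong +_ (sym (ℕ.m+[n∸m]≡n w₄≥w₃))) (cong (ℤ._+ + t) w₃≡)

    affine≡ : ∀ j {x} → + w j ≡ x → + f j ≡ + a ℤ.* x ℤ.+ + b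
    affine≡ j eq = cong (ℤ._+ + b) (trans (ℤ.pos-* a (w j)) (cong (+ a ℤ.*_) eq))

    -- F is the linear form in f 0, …, f 4 to which βℕ f d k unfolds for literal d and k.
    0≤βℕ : ∀ (F : ℤ → ℤ → ℤ → ℤ → ℤ → ℤ) x y →
      F (+ b) (+ a ℤ.+ + b) (+ a ℤ.* (+ 1 ℤ.+ + u) ℤ.+ + b)
        (+ a ℤ.* (+ 2 ℤ.* (+ 1 ℤ.+ + u) ℤ.+ + v) ℤ.+ + b)
        (+ a ℤ.* (+ 2 ℤ.* (+ 1 ℤ.+ + u) ℤ.+ + v ℤ.+ + t) ℤ.+ + b)
      ≡ + a ℤ.* + x ℤ.+ + y →
      0ℤ ≤ F (+ f 0) (+ f 1) (+ f 2) (+ f 3) (+ f 4)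
    0≤βℕ F x y eq = subst (0ℤ ≤_) (sym (begin
      F (+ f 0) (+ f 1) (+ f 2) (+ f 3) (+ f 4)
        ≡⟨ cong₂ (λ x₀ x₁ → F (+ x₀) (+ x₁) (+ f 2) (+ f 3) (+ f 4)) f₀ f₁ ⟩
      F (+ b) (+ (a ℕ.+ b)) (+ f 2) (+ f 3) (+ f 4)
        ≡⟨ cong₂ (λ x₂ x₃ → F (+ b) (+ (a ℕ.+ b)) x₂ x₃ (+ f 4)) (affine≡ 2 w₂≡) (affine≡ 3 w₃≡) ⟩
      _ ≡⟨ cong (F (+ b) (+ (a ℕ.+ b)) _ _) (affine≡ 4 w₄≡) ⟩
      _ ≡⟨ eq ⟩
      + a ℤ.* + x ℤ.+ + y ≡⟨ cong (ℤ._+ + y) (sym (ℤ.pos-* a x)) ⟩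
      + (a ℕ.* x ℕ.+ y)   ∎)) (ℤ.+≤+ z≤n)
      where open ≡-Reasoning

    -- The depth is `suc q` ≤ 4, so k ≤ 4 and the cases are finite. At k = 1 the claim is the
    -- hypothesis itself; for k = 3 and 4 the entry is rewritten as a x + y with natural x and y.
    nonnegative-small : ∀ {q} → q ℕ.≤ 3 → q ℕ.* b ℕ.≤ a → Nonnegative f (suc q)
    nonnegative-small {q} q≤3 q*b≤a {0} _ =
      subst (0ℤ ≤_) (sym (βℕ-zero f (suc q))) (ℤ.+≤+ z≤n)
    nonnegative-small {q} q≤3 q*b≤a {1} _ =
      subst (0ℤ ≤_) (sym (affine-βℕ-one q)) (ℤ.i≤j⇒0≤j-i (ℤ.+≤+ q*b≤a))
    nonnegative-small {zero} q≤3 q*b≤a {2} (s≤s (s≤s ()))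
    nonnegative-small {suc q} q≤3 q*b≤a {2} _ =
      -- Twice the entry is 2a (w 2 - e) + b (e (e - 1) + 2) with e = `suc q` ≤ 3 < w 2, so both
      -- summands are nonnegative.
      ℤ.*-cancelˡ-≤-pos 0ℤ (βℕ f (suc (suc q)) 2) (+ 2)
        (subst (0ℤ ≤_) (sym two) (ℤ.+≤+ z≤n))
      where
      w₂≥q : suc q ℕ.≤ w 2
      w₂≥q = ℕ.≤-trans q≤3 (ℕ.≤-trans (ℕ.n≤1+n 3) w₂≥4)
      s = w 2 ∸ suc q

      ring : ∀ a b q s →
        + 2 ℤ.* a ℤ.* ((s ℤ.+ (+ 1 ℤ.+ q)) ℤ.- (+ 1 ℤ.+ q))
          ℤ.+ b ℤ.* ((+ 1 ℤ.+ q) ℤ.* ((+ 1 ℤ.+ q) ℤ.- + 1) ℤ.+ + 2)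
        ≡ + 2 ℤ.* (a ℤ.* s) ℤ.+ b ℤ.* ((+ 1 ℤ.+ q) ℤ.* q ℤ.+ + 2)
      ring = solve-∀

      two : + 2 ℤ.* βℕ f (suc (suc q)) 2 ≡
            + (2 ℕ.* (a ℕ.* s) ℕ.+ b ℕ.* (suc q ℕ.* q ℕ.+ 2))
      two = trans (2*affine-βℕ-two (suc q))
        (trans (cong (λ x → + 2 ℤ.* + a ℤ.* (+ x ℤ.- + suc q)
            ℤ.+ + b ℤ.* (+ suc q ℤ.* (+ suc q ℤ.- + 1) ℤ.+ + 2))
          (sym (ℕ.m∸n+n≡m w₂≥q)))
        (trans (ring (+ a) (+ b) (+ q) (+ s))
        (sym (cong₂ ℤ._+_
          (trans (ℤ.pos-* 2 (a ℕ.* s)) (cong (+ 2 ℤ.*_) (ℤ.pos-* a s)))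
          (trans (ℤ.pos-* b (suc q ℕ.* q ℕ.+ 2))
            (cong (λ x → + b ℤ.* (x ℤ.+ + 2)) (ℤ.pos-* (suc q) q)))))))
    nonnegative-small {0} q≤3 q*b≤a {suc (suc (suc k))} (s≤s (s≤s ()))
    nonnegative-small {1} q≤3 q*b≤a {suc (suc (suc k))} (s≤s (s≤s (s≤s ())))
    -- All coefficients are 1 or -1 and b cancels, leaving a (1 - w 2 + w 3).
    nonnegative-small {2} q≤3 q*b≤a {3} _ = 0≤βℕ
      (λ x₀ x₁ x₂ x₃ _ → -1ℤ ℤ.* x₀ ℤ.+
        (+ 1 ℤ.* x₁ ℤ.+ (-1ℤ ℤ.* x₂ ℤ.+ (+ 1 ℤ.* x₃ ℤ.+ + 0))))
      (2 ℕ.+ (u ℕ.+ v)) 0 (ring (+ a) (+ b) (+ u) (+ v))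
      where
      ring : ∀ a b u v →
        -1ℤ ℤ.* b ℤ.+ (+ 1 ℤ.* (a ℤ.+ b) ℤ.+ (-1ℤ ℤ.* (a ℤ.* (+ 1 ℤ.+ u) ℤ.+ b)
           ℤ.+ (+ 1 ℤ.* (a ℤ.* (+ 2 ℤ.* (+ 1 ℤ.+ u) ℤ.+ v) ℤ.+ b) ℤ.+ + 0)))
           ≡ a ℤ.* (+ 2 ℤ.+ (u ℤ.+ v)) ℤ.+ + 0
      ring = solve-∀
    -- The entry is a (3 - 2 w 2 + w 3) - 2b: here w 3 ≥ 2 w 2 matters, and 2b is absorbed by 2a
    -- since b ≤ a.
    nonnegative-small {3} q≤3 q*b≤a {3} _ = 0≤βℕ
      (λ x₀ x₁ x₂ x₃ _ → -[1+ 3 ] ℤ.* x₀ ℤ.+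
        (+ 3 ℤ.* x₁ ℤ.+ (-[1+ 1 ] ℤ.* x₂ ℤ.+ (+ 1 ℤ.* x₃ ℤ.+ + 0))))
      (1 ℕ.+ v) (r ℕ.+ r) (trans (ring (+ a) (+ b) (+ u) (+ v))
        (cong (λ x → + a ℤ.* (+ 1 ℤ.+ + v) ℤ.+ (x ℤ.+ x)) (trans (ℤ.m-n≡m⊖n a b) (ℤ.⊖-≥ b≤a))))
      where
      b≤a : b ℕ.≤ a
      b≤a = ℕ.≤-trans (ℕ.m≤m+n b _) q*b≤a
      r = a ∸ b
      ring : ∀ a b u v →
        -[1+ 3 ] ℤ.* b ℤ.+ (+ 3 ℤ.* (a ℤ.+ b) ℤ.+ (-[1+ 1 ] ℤ.* (a ℤ.* (+ 1 ℤ.+ u) ℤ.+ b)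
           ℤ.+ (+ 1 ℤ.* (a ℤ.* (+ 2 ℤ.* (+ 1 ℤ.+ u) ℤ.+ v) ℤ.+ b) ℤ.+ + 0)))
           ≡ a ℤ.* (+ 1 ℤ.+ v) ℤ.+ (a ℤ.- b ℤ.+ (a ℤ.- b))
      ring = solve-∀
    -- The alternating sum is a (w 2 - 1 + w 4 - w 3) + b.
    nonnegative-small {3} q≤3 q*b≤a {4} _ = 0≤βℕ
      (λ x₀ x₁ x₂ x₃ x₄ → + 1 ℤ.* x₀ ℤ.+
        (-1ℤ ℤ.* x₁ ℤ.+ (+ 1 ℤ.* x₂ ℤ.+ (-1ℤ ℤ.* x₃ ℤ.+ (+ 1 ℤ.* x₄ ℤ.+ + 0)))))
      (u ℕ.+ t) b (ring (+ a) (+ b) (+ u) (+ v) (+ t))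
      where
      ring : ∀ a b u v t →
        + 1 ℤ.* b ℤ.+ (-1ℤ ℤ.* (a ℤ.+ b) ℤ.+ (+ 1 ℤ.* (a ℤ.* (+ 1 ℤ.+ u) ℤ.+ b)
           ℤ.+ (-1ℤ ℤ.* (a ℤ.* (+ 2 ℤ.* (+ 1 ℤ.+ u) ℤ.+ v) ℤ.+ b)
           ℤ.+ (+ 1 ℤ.* (a ℤ.* (+ 2 ℤ.* (+ 1 ℤ.+ u) ℤ.+ v ℤ.+ t) ℤ.+ b) ℤ.+ + 0))))
           ≡ a ℤ.* (u ℤ.+ t) ℤ.+ b
      ring = solve-∀
    nonnegative-small {2} q≤3 q*b≤a {suc (suc (suc (suc k)))} (s≤s (s≤s (s≤s (s≤s ()))))
    nonnegative-small {3} q≤3 q*b≤a {suc (suc (suc (suc (suc k))))} (s≤s (s≤s (s≤s (s≤s (s≤s ())))))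
    nonnegative-small {suc (suc (suc (suc q)))} (s≤s (s≤s (s≤s ())))

-- Elimination principles for the branches of `eq`.

if-elim : ∀ {A P : Set} (R : A → Set) (P? : Dec P) {x y} →
          (P → R x) → (¬ P → R y) → R (if does P? then x else y)
if-elim R (yes p) r s = r p
if-elim R (no ¬p) r s = s ¬p

-- A failed search supplies that `P` fails on the whole list; the unbounded last interval of `eq`
-- relies on this.
maybe-find-elim : ∀ {A B : Set} {P : A → Set} (R : B → Set) (P? : Decidable P) {g y} xs →
  (∀ {x} → x ∈ xs → P x → R (g x)) → (All (¬_ ∘ P) xs → R y) →
  R (maybe g y (find P? xs))
maybe-find-elim R P? []       r s = s []
maybe-find-elim R P? (x ∷ xs) r s with P? x
... | yes p = r (here refl) p
... | no ¬p = maybe-find-elim R P? xs (r ∘ there) (s ∘ (¬p ∷_))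

-- Powers of two and the thresholds λ_i.

i<j⇒i-j<0 : ∀ {i j} → i ℤ.< j → i ℤ.- j ℤ.< 0ℤ
i<j⇒i-j<0 {i} {j} i<j = subst (i ℤ.- j ℤ.<_) (ℤ.+-inverseʳ j) (ℤ.+-monoˡ-< (ℤ.- j) i<j)

-- Two factors are split off: 8 ≤ 9, and the remaining powers compare by monotonicity.
2*2^n≤3^n : ∀ {n} → 2 ≤ᴺ n → 2 ℕ.* 2 ℕ.^ n ≤ᴺ 3 ℕ.^ n
2*2^n≤3^n {suc (suc n)} (s≤s (s≤s z≤n)) = begin
  2 ℕ.* (2 ℕ.* (2 ℕ.* 2 ℕ.^ n)) ≡⟨ assoc 2 (2 ℕ.^ n) ⟩
  8 ℕ.* 2 ℕ.^ n                 ≤⟨ ℕ.*-mono-≤ (ℕ.n≤1+n 8) (ℕ.^-monoˡ-≤ n (ℕ.n≤1+n 2)) ⟩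
  9 ℕ.* 3 ℕ.^ n                 ≡⟨ ℕ.*-assoc 3 3 (3 ℕ.^ n) ⟩
  3 ℕ.* (3 ℕ.* 3 ℕ.^ n)         ∎
  where
  open ℕ.≤-Reasoning
  assoc : ∀ k x → k ℕ.* (k ℕ.* (k ℕ.* x)) ≡ (k ℕ.* k ℕ.* k) ℕ.* x
  assoc k x = sym (trans (ℕ.*-assoc (k ℕ.* k) k x) (ℕ.*-assoc k k (k ℕ.* x)))

2^[n+1]≡2^n+2^n : ∀ n → 2 ℕ.^ (n ℕ.+ 1) ≡ 2 ℕ.^ n ℕ.+ 2 ℕ.^ n
2^[n+1]≡2^n+2^n n = trans (cong (2 ℕ.^_) (ℕ.+-comm n 1))
  (cong (2 ℕ.^ n ℕ.+_) (ℕ.+-identityʳ (2 ℕ.^ n)))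

2^[2n]≡2^n*2^n : ∀ n → 2 ℕ.^ (2 ℕ.* n) ≡ 2 ℕ.^ n ℕ.* 2 ℕ.^ n
2^[2n]≡2^n*2^n n = trans (cong (λ x → 2 ℕ.^ (n ℕ.+ x)) (ℕ.+-identityʳ n))
  (ℕ.^-distribˡ-+-* 2 n n)

-- In terms of N = 2 ^ n.  The square is unfolded, with its factor + 1, because
-- the ring solver does not see through _^_.
lamNumerator : ℤ → ℤ → ℤ
lamNumerator N m =
  m ℤ.* (m ℤ.* + 1) ℤ.+ m ℤ.* (N ℤ.+ N ℤ.- + 3) ℤ.+ N ℤ.* N ℤ.- + 3 ℤ.* N ℤ.+ + 4

lam-denominator : ∀ t → suc (2 ℕ.* (2 ℕ.+ t) ∸ 3) ≡ 2 ℕ.* (1 ℕ.+ t)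
lam-denominator t =
  trans (cong (λ x → suc (x ∸ 3)) (ℕ.*-distribˡ-+ 2 2 t)) (sym (ℕ.*-distribˡ-+ 2 1 t))

-- Writing m = 2 + t with m + j = N + 1 removes the truncated subtraction and makes the denominator
-- 2 (1 + t) visibly positive.
lam≡ : ∀ {n j} t → 2 ℕ.+ t ℕ.+ j ≡ 2 ℕ.^ n ℕ.+ 1 →
  lam n j ≡ mkℚᵘ (lamNumerator (+ 2 ℕ.^ n) (+ 2 ℤ.+ + t)) (2 ℕ.* (2 ℕ.+ t) ∸ 3)
lam≡ {n} {j} t eq = trans
  (cong (lamWith (+ 2 ℕ.^ (n ℕ.+ 1)) (+ 2 ℕ.^ (2 ℕ.* n)))
    (trans (cong (_∸ j) (sym eq)) (ℕ.m+n∸n≡m (2 ℕ.+ t) j)))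
  (cong₂ (λ x y → lamWith x y (2 ℕ.+ t))
    (cong +_ (2^[n+1]≡2^n+2^n n))
    (trans (cong +_ (2^[2n]≡2^n*2^n n)) (ℤ.pos-* (2 ℕ.^ n) (2 ℕ.^ n))))
  where
  lamWith : ℤ → ℤ → ℕ → ℚᵘ
  lamWith N₂ N² m = mkℚᵘ
    (+ m ℤ.* (+ m ℤ.* + 1) ℤ.+ + m ℤ.* (N₂ ℤ.- + 3) ℤ.+ N² ℤ.- + 3 ℤ.* + (2 ℕ.^ n) ℤ.+ + 4)
    (2 ℕ.* m ∸ 3)

-- The left side is 2 β_2 at depth N + m with m = 2 + t, so the sign of β_2 there is that of λ - α.
lamNumerator-β : ∀ a b N t →
  + 2 ℤ.* a ℤ.* (N ℤ.- (N ℤ.+ (+ 1 ℤ.+ t)))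
    ℤ.+ b ℤ.* ((N ℤ.+ (+ 1 ℤ.+ t)) ℤ.* (N ℤ.+ (+ 1 ℤ.+ t) ℤ.- + 1) ℤ.+ + 2)
  ≡ lamNumerator N (+ 2 ℤ.+ t) ℤ.* b ℤ.- a ℤ.* (+ 2 ℤ.* (+ 1 ℤ.+ t))
lamNumerator-β = ring
  where
  ring : ∀ a b N t →
    + 2 ℤ.* a ℤ.* (N ℤ.- (N ℤ.+ (+ 1 ℤ.+ t)))
      ℤ.+ b ℤ.* ((N ℤ.+ (+ 1 ℤ.+ t)) ℤ.* (N ℤ.+ (+ 1 ℤ.+ t) ℤ.- + 1) ℤ.+ + 2)
    ≡ ((+ 2 ℤ.+ t) ℤ.* ((+ 2 ℤ.+ t) ℤ.* + 1) ℤ.+ (+ 2 ℤ.+ t) ℤ.* (N ℤ.+ N ℤ.- + 3)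
        ℤ.+ N ℤ.* N ℤ.- + 3 ℤ.* N ℤ.+ + 4) ℤ.* b
      ℤ.- a ℤ.* (+ 2 ℤ.* (+ 1 ℤ.+ t))
  ring = solve-∀

-- At i = 1 this says λ₁ < 2N.
lamNumerator-diagonal : ∀ N t → + 2 ℤ.+ t ≡ N →
  lamNumerator N (+ 2 ℤ.+ t) ℤ.+ + 2 ℤ.* t ≡ (N ℤ.+ N) ℤ.* (+ 2 ℤ.* (+ 1 ℤ.+ t))
lamNumerator-diagonal _ t refl = ring t
  where
  ring : ∀ t →
    (+ 2 ℤ.+ t) ℤ.* ((+ 2 ℤ.+ t) ℤ.* + 1)
      ℤ.+ (+ 2 ℤ.+ t) ℤ.* ((+ 2 ℤ.+ t) ℤ.+ (+ 2 ℤ.+ t) ℤ.- + 3)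
      ℤ.+ (+ 2 ℤ.+ t) ℤ.* (+ 2 ℤ.+ t) ℤ.- + 3 ℤ.* (+ 2 ℤ.+ t) ℤ.+ + 4 ℤ.+ + 2 ℤ.* t
    ≡ ((+ 2 ℤ.+ t) ℤ.+ (+ 2 ℤ.+ t)) ℤ.* (+ 2 ℤ.* (+ 1 ℤ.+ t))
  ring = solve-∀

0^n≡0 : ∀ {n} → 2 ≤ᴺ n → 0 ℕ.^ n ≡ 0
0^n≡0 (s≤s _) = refl

-- Comparison of the depth with `eq`.

module _ (n a b-1 : ℕ) (n≥2 : 2 ≤ᴺ n) where

  private
    b = suc b-1
    α = mkℚᵘ (+ a) b-1
    f = affine (ℕ._^ n) a b
    N = 2 ℕ.^ n

    w₀ = 0^n≡0 n≥2
    w₁ = ℕ.^-zeroˡ n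

    N≥4 : 4 ≤ᴺ N
    N≥4 = ℕ.^-monoʳ-≤ 2 n≥2

    2+[N-2]≡N : 2 ℕ.+ (N ∸ 2) ≡ N
    2+[N-2]≡N = ℕ.m+[n∸m]≡n (ℕ.≤-trans (s≤s (s≤s z≤n)) N≥4)

    d*b≤a : ∀ {d} → Nonnegative f (suc d) → d ℕ.* b ℕ.≤ a
    d*b≤a = nonnegative⇒d*b≤a (ℕ._^ n) w₀ w₁ a b

  -- Cross-multiplying λ_j < α makes the right side of `lamNumerator-β` negative.
  lam<⇒¬nonnegative : ∀ {j t} → 2 ℕ.+ t ℕ.+ j ≡ N ℕ.+ 1 → lam n j ℚ.< α →
                      ¬ Nonnegative f (suc (N ℕ.+ (1 ℕ.+ t)))
  lam<⇒¬nonnegative {j} {t} eq lam<α p = 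
    ℤ.<⇒≱ negative (ℤ.*-monoˡ-≤-nonNeg (+ 2)
      (p (s≤s (s≤s (ℕ.m≤n⇒m≤n+o _ (ℕ.≤-trans (s≤s z≤n) N≥4))))))
    where
    e = N ℕ.+ (1 ℕ.+ t)

    negative : + 2 ℤ.* βℕ f (suc e) 2 ℤ.< 0ℤ
    negative = subst (ℤ._< 0ℤ)
      (sym (trans (2*affine-βℕ-two (ℕ._^ n) w₀ w₁ a b e)
        (trans (lamNumerator-β (+ a) (+ b) (+ N) (+ t))
          (cong (λ x → lamNumerator (+ N) (+ 2 ℤ.+ + t) ℤ.* + b ℤ.- + a ℤ.* x)
            (sym (trans (cong +_ (lam-denominator t)) (ℤ.pos-* 2 (1 ℕ.+ t))))))))
      (i<j⇒i-j<0 (ℚ.drop-*<* (subst (ℚ._< α) (lam≡ {n} {j} t eq) lam<α)))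

  ≤lam₁⇒a<2N*b : α ℚ.≤ lam n 1 → a ℕ.< (N ℕ.+ N) ℕ.* b
  ≤lam₁⇒a<2N*b α≤lam = ℤ.drop‿+<+
    (ℤ.*-cancelʳ-<-nonNeg (+ suc (2 ℕ.* (2 ℕ.+ t) ∸ 3))
      (ℤ.≤-<-trans
        (ℚ.drop-*≤* (subst (α ℚ.≤_) (lam≡ {n} {1} t (cong (ℕ._+ 1) N≡)) α≤lam))
        strict))
    where
    -- This is N - 2 in successor form, so that 0 < 2 t, the source of strictness, holds by
    -- computation.
    t = suc (N ∸ 3)

    N≡ : 2 ℕ.+ t ≡ N
    N≡ = ℕ.m+[n∸m]≡n (ℕ.≤-trans (ℕ.n≤1+n 3) N≥4)

    num = lamNumerator (+ N) (+ 2 ℤ.+ + t)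

    strict : num ℤ.* + b ℤ.< + ((N ℕ.+ N) ℕ.* b) ℤ.* + suc (2 ℕ.* (2 ℕ.+ t) ∸ 3)
    strict = begin-strict
      num ℤ.* + b
        <⟨ ℤ.*-monoʳ-<-pos (+ b) (subst (ℤ._< num ℤ.+ + 2 ℤ.* + t) (ℤ.+-identityʳ num)
             (ℤ.+-monoʳ-< num (ℤ.+<+ (s≤s z≤n)))) ⟩
      (num ℤ.+ + 2 ℤ.* + t) ℤ.* + b
        ≡⟨ cong (ℤ._* + b) (lamNumerator-diagonal (+ N) (+ t) (cong +_ N≡)) ⟩
      + (N ℕ.+ N) ℤ.* (+ 2 ℤ.* (+ 1 ℤ.+ + t)) ℤ.* + b
        ≡⟨ ring (+ (N ℕ.+ N)) (+ 2 ℤ.* (+ 1 ℤ.+ + t)) (+ b) ⟩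
      + (N ℕ.+ N) ℤ.* + b ℤ.* (+ 2 ℤ.* (+ 1 ℤ.+ + t))
        ≡⟨ cong₂ ℤ._*_ (sym (ℤ.pos-* (N ℕ.+ N) b)) (cong +_ (sym (lam-denominator t))) ⟩
      + ((N ℕ.+ N) ℕ.* b) ℤ.* + suc (2 ℕ.* (2 ℕ.+ t) ∸ 3) ∎
      where
      open ℤ.≤-Reasoning
      ring : ∀ x y z → x ℤ.* y ℤ.* z ≡ x ℤ.* z ℤ.* y
      ring = solve-∀

  floor-α : floor α ≡ + (a ℕ./ b)
  floor-α = ℤ.div-pos-is-/ℕ (+ a) b

  c≡ : c α ≡ + suc (a ℕ./ b)
  c≡ = trans (cong (ℤ._+ + 1) floor-α) (cong +_ (ℕ.+-comm (a ℕ./ b) 1))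

  module _ {D : ℕ} (max : IsMaximum (Nonnegative f) D) where

    private
      D<d : ∀ {d} → ¬ Nonnegative f d → D ℕ.< d
      D<d ¬p = ℕ.≰⇒> λ d≤D →
        ¬p (downward (nonnegative? f) (nonnegative-pred f) d≤D (proj₁ max))

    D≤c : + D ≤ c α
    -- With q the quotient of a by b, admissibility of depth q + 2 would give (q + 1) b ≤ a, hence q
    -- + 1 ≤ q.
    D≤c = subst (+ D ≤_) (sym c≡) (ℤ.+≤+ (ℕ.s≤s⁻¹ (D<d λ p →
      ℕ.1+n≰n (subst (ℕ._≤ a ℕ./ b) (ℕ.m*n/n≡m (suc (a ℕ./ b)) b)
        (ℕ./-monoˡ-≤ b (d*b≤a p))))))

    a<d*b⇒D≤d : ∀ {d} → a ℕ.< d ℕ.* b → D ≤ᴺ d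
    a<d*b⇒D≤d a<d*b = ℕ.s≤s⁻¹ (D<d λ p → ℕ.<⇒≱ a<d*b (d*b≤a p))

    lam<α⇒D≤ : ∀ {j t} → 2 ℕ.+ t ℕ.+ j ≡ N ℕ.+ 1 → lam n j ℚ.< α →
               D ≤ᴺ N ℕ.+ (1 ℕ.+ t)
    lam<α⇒D≤ eq lam<α = ℕ.s≤s⁻¹ (D<d (lam<⇒¬nonnegative eq lam<α))

    D≤eq : + D ≤ eq n α
    D≤eq = if-elim (+ D ≤_) (α ℚ.<? (+ (2 ℕ.^ (n ℕ.+ 1)) ℤ.- + 1) ℚ./ 1)
      (λ _ → D≤c)
      λ _ → if-elim (+ D ≤_) (α ℚ.≤? lam n 1)
        (λ α≤lam → ℤ.+≤+ (subst (D ≤ᴺ_) (sym (2^[n+1]≡2^n+2^n n))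
          (a<d*b⇒D≤d (≤lam₁⇒a<2N*b α≤lam))))
        λ α≰lam → maybe-find-elim (+ D ≤_)
          (λ i → (lam n (i ∸ 1) ℚ.<? α) ×-dec (α ℚ.≤? lam n i)) (middleIndices n)
          (λ i∈ (lam<α , _) → middle (∈-applyUpTo⁻ (2 ℕ.+_) i∈) lam<α)
          -- Beyond the last threshold j = N - 1, so m = 2, t = 0 and the bound is N + 1.
          λ none → ℤ.+≤+ (lam<α⇒D≤ {1 ℕ.+ (N ∸ 2)} {0}
            (trans (cong suc 2+[N-2]≡N) (ℕ.+-comm 1 N))
            (above (ℚ.≰⇒> α≰lam) (applyUpTo⁻ (2 ℕ.+_) (N ∸ 2) none) ℕ.≤-refl))
      where
      middle : ∀ {i} → ∃[ k ] (k ℕ.< N ∸ 2 × i ≡ 2 ℕ.+ k) → lam n (i ∸ 1) ℚ.< α →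
               + D ≤ + (2 ℕ.^ (n ℕ.+ 1)) ℤ.+ + 1 ℤ.- + i
      middle (k , k<N-2 , refl) lam<α =
        subst (+ D ≤_) (sym value) (ℤ.+≤+ (lam<α⇒D≤ index lam<α))
        where
        -- The lower endpoint has index j = k + 1, so m = N - k and t = m - 2.
        t = N ∸ 2 ∸ k

        N≡ : N ≡ 2 ℕ.+ (k ℕ.+ t)
        N≡ = sym (trans (cong (2 ℕ.+_) (ℕ.m+[n∸m]≡n (ℕ.<⇒≤ k<N-2))) 2+[N-2]≡N)

        index : 2 ℕ.+ t ℕ.+ suc k ≡ N ℕ.+ 1
        index = trans
          (cong (2 ℕ.+_) (trans (ℕ.+-comm t (suc k)) (ℕ.+-comm 1 (k ℕ.+ t))))
          (cong (ℕ._+ 1) (sym N≡))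

        ring : ∀ N k t →
          (N ℤ.+ (+ 2 ℤ.+ (k ℤ.+ t))) ℤ.+ + 1 ℤ.- (+ 2 ℤ.+ k) ≡ N ℤ.+ (+ 1 ℤ.+ t)
        ring = solve-∀

        value : + (2 ℕ.^ (n ℕ.+ 1)) ℤ.+ + 1 ℤ.- + (2 ℕ.+ k) ≡ + (N ℕ.+ (1 ℕ.+ t))
        value = trans (cong (λ x → + x ℤ.+ + 1 ℤ.- + (2 ℕ.+ k))
          (trans (2^[n+1]≡2^n+2^n n) (cong (N ℕ.+_) N≡))) (ring (+ N) (+ k) (+ t))

      -- The thresholds are climbed one at a time: α exceeds one and misses the interval ending at
      -- the next, so it exceeds the next.
      above : lam n 1 ℚ.< α →
              (∀ {k} → k ℕ.< N ∸ 2 → ¬ (lam n (1 ℕ.+ k) ℚ.< α × α ℚ.≤ lam n (2 ℕ.+ k))) →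
              ∀ {k} → k ℕ.≤ N ∸ 2 → lam n (1 ℕ.+ k) ℚ.< α
      above base none {zero}  _     = base
      above base none {suc k} k<N-2 = ℚ.≰⇒> λ α≤lam →
        none k<N-2 (above base none (ℕ.<⇒≤ k<N-2) , α≤lam)

    -- Here α < 4 ≤ 2^(n+1) - 1 selects the first branch of `eq`, and depth `c α` is admissible by
    -- `nonnegative-small`.
    c≤4⇒D≡eq : c α ≤ + 4 → + D ≡ eq n α
    c≤4⇒D≡eq c≤4 = sym (if-elim (_≡ + D) (α ℚ.<? (+ (2 ℕ.^ (n ℕ.+ 1)) ℤ.- + 1) ℚ./ 1)
      (λ _ → ℤ.≤-antisym c≤D D≤c)
      (contradiction α<2N-1))
      where
      q = a ℕ./ b

      q≤3 : q ≤ᴺ 3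
      q≤3 = ℕ.s≤s⁻¹ (ℤ.drop‿+≤+ (subst (_≤ + 4) c≡ c≤4))

      a<[1+q]*b : a ℕ.< suc q ℕ.* b
      a<[1+q]*b = subst (ℕ._< suc q ℕ.* b) (sym (ℕ.m≡m%n+[m/n]*n a b))
        (ℕ.+-monoˡ-< (q ℕ.* b) (ℕ.m%n<n a b))

      c≤D : c α ≤ + D
      c≤D = subst (_≤ + D) (sym c≡) (ℤ.+≤+ (proj₂ max (suc q)
        (nonnegative-small (ℕ._^ n) w₀ w₁ a b N≥4 (2*2^n≤3^n n≥2)
          (ℕ.^-monoˡ-≤ n (ℕ.n≤1+n 3)) q≤3 (ℕ.m/n*n≤m a b))))

      α<2N-1 : α ℚ.< (+ (2 ℕ.^ (n ℕ.+ 1)) ℤ.- + 1) ℚ./ 1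
      α<2N-1 = ℚ.*<* (subst₂ ℤ._<_ (sym (ℤ.*-identityʳ (+ a)))
        (trans (ℤ.pos-* (ℕ.pred K) b)
          (cong (λ x → (+ x ℤ.- + 1) ℤ.* + b)
            (ℕ.suc-pred K {{ℕ.>-nonZero (ℕ.≤-trans (s≤s z≤n) K≥5)}})))
        (ℤ.+<+ (ℕ.<-≤-trans a<[1+q]*b
          (ℕ.*-monoˡ-≤ b (ℕ.≤-trans (s≤s q≤3) (ℕ.pred-mono-≤ K≥5))))))
        where
        K = 2 ℕ.^ (n ℕ.+ 1)

        K≥5 : 5 ≤ᴺ K
        K≥5 = subst (5 ≤ᴺ_) (sym (2^[n+1]≡2^n+2^n n))
          (ℕ.+-mono-≤ N≥4 (ℕ.≤-trans (s≤s z≤n) N≥4))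

theorem3p9 : (n a b : ℕ) → 2 ≤ᴺ n → .{{_ : NonZero a}} → .{{_ : NonZero b}} →
    ∃[ D ] (IsHdepth (powerFunction n a b) D
    × D ≤ eq n (+ a / b)
    × (c (+ a / b) ≤ + 4 → D ≡ eq n (+ a / b)))
theorem3p9 n a b@(suc b-1) n≥2 =
  let f = affine (ℕ._^ n) a b
      -- The search starts at depth 2 + a, whose admissibility would force (1 + a) b ≤ a.
      D , max = maximum (nonnegative? f) (nonnegative-pred f) (nonnegative-zero f) (2 ℕ.+ a)
        λ p → ℕ.1+n≰n (ℕ.≤-trans (ℕ.m≤m*n (suc a) b)
          (nonnegative⇒d*b≤a (ℕ._^ n) (0^n≡0 n≥2) (ℕ.^-zeroˡ n) a b p))
  in + D , isHdepth (powerFunction n a b) refl max ,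
     D≤eq n a b-1 n≥2 max , c≤4⇒D≡eq n a b-1 n≥2 max
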